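{- Let $p$ be a prime and $n$ a positive integer such that $p^2\mid n$. Let $\Phi_n(x)=\sum_{k=0}^{\varphi(n)}a_n(k)x^k$ be the $n$-th cyclotomic polynomial. Then $a_n(k)=0$ whenever $p\nmid k$.
   Context: $\varphi$ denotes Euler's totient function; $a_n(k)$ is the coefficient of $x^k$ in $\Phi_n(x)$. -}

module Defs where

open import Data.Bool using (if_then_else_)
open import Data.Fin using (Fin; toℕ)
open import Data.Fin.Properties using (toℕ<n)
open import Data.Integer using (ℤ; -_; 0ℤ; 1ℤ; -1ℤ; _+_; _*_; _≟_)
open import Data.List using (List; []; _∷_; map; filter; foldr; replicate; allFin; _++_)
open import Data.List.Relation.Unary.All using (all?)
open import Data.Nat using (ℕ; zero; suc)
open import Data.Nat.Divisibility using (_∣?_)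
open import Data.Nat.Induction using (<-rec)
open import Data.Product using (_×_; _,_; proj₁)
open import Relation.Nullary.Decidable using (⌊_⌋)

-- Elements of ℤ[x]: coefficients, constant term first. Trailing zeros are
-- allowed, so two lists represent the same polynomial when their `coeff`
-- functions agree.
Poly : Set
Poly = List ℤ

coeff : Poly → ℕ → ℤ
coeff []      _       = 0ℤ
coeff (a ∷ p) zero    = a
coeff (a ∷ p) (suc k) = coeff p k

-- Trailing zeros are ignored; the zero polynomial gets degree 0.
degree : Poly → ℕ
degree []      = 0
degree (a ∷ p) = if ⌊ all? (_≟ 0ℤ) p ⌋ then 0 else suc (degree p)

infixl 6 _⊕_
infixl 7 _⊗_ _·_

_⊕_ : Poly → Poly → Poly
[]      ⊕ q       = q
(a ∷ p) ⊕ []      = a ∷ p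
(a ∷ p) ⊕ (b ∷ q) = a + b ∷ p ⊕ q

_·_ : ℤ → Poly → Poly
c · p = map (c *_) p

_⊗_ : Poly → Poly → Poly
[]      ⊗ q = []
(a ∷ p) ⊗ q = a · q ⊕ (0ℤ ∷ p ⊗ q)

∏ : List Poly → Poly
∏ = foldr _⊗_ (1ℤ ∷ [])

xⁿ-1 : ℕ → Poly
xⁿ-1 n = (-1ℤ ∷ []) ⊕ (replicate n 0ℤ ++ 1ℤ ∷ [])

-- Long division; returns quotient and remainder when the divisor d is monic.
-- If p = q d + r with deg r < deg d (or r = 0), then a + x p = (x q) d + (a + x r)
-- and a + x r has degree at most deg d, so one further multiple c d, with c its
-- coefficient at x^(deg d), is taken off.
divMod : Poly → Poly → Poly × Poly
divMod []      d = [] , []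
divMod (a ∷ p) d =
  let q , r = divMod p d
      c     = coeff (a ∷ r) (degree d)
  in  c ∷ q , (a ∷ r) ⊕ (- c) · d

_quot_ : Poly → Poly → Poly
p quot d = proj₁ (divMod p d)

-- Φ n = (xⁿ - 1) / ∏ { Φ d : d ∣ n, d < n }, i.e. the recursion on n ≥ 1 given by
-- xⁿ - 1 = ∏ { Φ d : d ∣ n }. As 0 ∣ n only for n = 0, the index d = 0 never
-- contributes. The value at n = 0 is meaningless.
Φ : ℕ → Poly
Φ = <-rec (λ _ → Poly) λ n Φ< →
  xⁿ-1 n quot ∏ (map (λ (d : Fin n) → Φ< (toℕ<n d)) (filter (λ d → toℕ d ∣? n) (allFin n)))

a : ℕ → ℕ → ℤ
a n k = coeff (Φ n) k

{-# OPTIONS --safe #-}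
-- Φ n is by definition the quotient of xⁿ - 1 by D = ∏ { Φ d : d ∣ n, d < n }. Long division of
-- polynomials all of whose exponents are multiples of p yields such a polynomial again, so it
-- suffices that D is one. Write n = m p with p ∣ m. The divisors of m contribute xᵐ - 1, and a
-- divisor d of n with d ∤ m satisfies p² ∣ d, so Φ d is covered by induction when d < n.
--
-- This uses that the divisions are exact. For distinct d and e the ideal (Φ d, Φ e) of ℤ[x]
-- contains a nonzero integer: if e ∤ d and g = gcd d e, then Φ e divides
-- B = (xᵉ - 1) / (xᵍ - 1), where B ≡ e / g modulo xᵍ - 1, and xᵍ - 1 lies in the ideal
-- (xᵈ - 1, xᵉ - 1). Hence D divides N (xⁿ - 1) for some integer N ≠ 0, and as D is monic it
-- divides xⁿ - 1.
module Submission where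

open import Defs
open import Algebra.Bundles using (CommutativeMonoid; CommutativeRing)
import Algebra.Properties.Group as GroupProperties
import Algebra.Properties.Ring as RingProperties
import Algebra.Properties.Semiring.Exp as Exp
import Algebra.Properties.Semiring.Mult as Mult
import Algebra.Solver.Ring.NaturalCoefficients.Default as SemiringSolver
open import Data.Nat as ℕ using (ℕ; zero; suc; NonZero; _^_; _<_; _≤_; s≤s; s<s; z<s; nonTrivial⇒n>1)
open import Data.Product using (_×_; _,_; ∃; ∃₂; proj₁; proj₂)

-- Identities valid in every commutative ring.

module CommutativeRingIdentities {c ℓ} (R : CommutativeRing c ℓ) where
  open CommutativeRing R
  open Exp semiring renaming (_^_ to _↑_)
  open Mult semiring renaming (_×_ to _⊠_)
  open import Relation.Binary.Reasoning.Setoid setoid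
  open GroupProperties +-group using (x≈z//y; ∙-cancelˡ)
  open RingProperties ring using (-‿distribˡ-*)
  open SemiringSolver commutativeSemiring using (solve; _:=_; _:+_; _:*_; con)

  -- `B` is the geometric sum 1 + y + ... + y^(q-1). Each of its q terms is 1 modulo `t`, which
  -- gives the second relation.
  geometric : ∀ {y t} → y ≈ 1# + t → ∀ q →
    ∃₂ λ B B′ → y ↑ q ≈ 1# + t * B × B ≈ q ⊠ 1# + t * B′
  geometric {y} {t} y≈1+t zero = 0# , 0# , +t*0 1# , +t*0 0#
    where
      +t*0 : ∀ a → a ≈ a + t * 0#
      +t*0 a = sym (trans (+-congˡ (zeroʳ t)) (+-identityʳ a))
  geometric {y} {t} y≈1+t (suc q) with geometric y≈1+t q
  -- The new sum is 1 + y B with y = 1 + t expanded; its summand t B is what turns `B′` into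
  -- `B′ + B`.
  ... | B , B′ , yq , Bq = 1# + B + t * B , B′ + B ,
      (begin
        y * y ↑ q                  ≈⟨ *-cong y≈1+t yq ⟩
        (1# + t) * (1# + t * B)
          ≈⟨ solve 2 (λ t B → (con 1 :+ t) :* (con 1 :+ t :* B) := con 1 :+ t :* (con 1 :+ B :+ t :* B)) refl t B ⟩
        1# + t * (1# + B + t * B)  ∎) ,
      (begin
        1# + B + t * B                   ≈⟨ +-congʳ (+-congˡ Bq) ⟩
        1# + (q ⊠ 1# + t * B′) + t * B
          ≈⟨ solve 4 (λ n t B B′ → con 1 :+ (n :+ t :* B′) :+ t :* B := con 1 :+ n :+ t :* (B′ :+ B)) refl (q ⊠ 1#) t B B′ ⟩
        1# + q ⊠ 1# + t * (B′ + B)       ∎)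

  -- The product on the left is 1 + t + (1 + t) r. With 1 + t, 1 + r and 1 + s powers of X, this
  -- turns an addition of exponents into an ideal membership.
  1+-cancel : ∀ {t r s} → (1# + t) * (1# + r) ≈ 1# + s → t ≈ s + (- (1# + t)) * r
  1+-cancel {t} {r} {s} eq = begin
    t                      ≈⟨ x≈z//y t ((1# + t) * r) s (∙-cancelˡ 1# _ _ (trans expand eq)) ⟩
    s - (1# + t) * r       ≈⟨ +-congˡ (-‿distribˡ-* (1# + t) r) ⟩
    s + (- (1# + t)) * r   ∎
    where
      expand : 1# + (t + (1# + t) * r) ≈ (1# + t) * (1# + r)
      expand = solve 2 (λ t r → con 1 :+ (t :+ (con 1 :+ t) :* r) := (con 1 :+ t) :* (con 1 :+ r)) refl t r

  -- t B′ lies in the ideal generated by s and B, hence so does n = B - t B′.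
  comaximal : ∀ {n t s B B′ u v} → B ≈ n + t * B′ → t ≈ u * s + v * (t * B) →
    (- (B′ * u)) * s + (1# + (- (B′ * v * t))) * B ≈ n
  comaximal {n} {t} {s} {B} {B′} {u} {v} B≈ t≈ = begin
    (- x) * s + (1# + (- y)) * B
      -- The solver knows no negation, so `- x` and `- y` enter it as independent variables and are
      -- cancelled against `x` and `y` afterwards.
      ≈⟨ solve 4 (λ -x -y s B → -x :* s :+ (con 1 :+ -y) :* B := -x :* s :+ -y :* B :+ B) refl (- x) (- y) s B ⟩
    (- x) * s + (- y) * B + B                           ≈⟨ +-congˡ (trans B≈ (+-congˡ (*-congʳ t≈))) ⟩
    (- x) * s + (- y) * B + (n + (u * s + v * (t * B)) * B′)
      ≈⟨ solve 9 (λ -x -y n t s B B′ u v →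
           -x :* s :+ -y :* B :+ (n :+ (u :* s :+ v :* (t :* B)) :* B′)
           := n :+ ((-x :+ B′ :* u) :* s :+ (-y :+ B′ :* v :* t) :* B))
         refl (- x) (- y) n t s B B′ u v ⟩
    n + ((- x + x) * s + (- y + y) * B)
      ≈⟨ +-congˡ (+-cong (*-congʳ (-‿inverseˡ x)) (*-congʳ (-‿inverseˡ y))) ⟩
    n + (0# * s + 0# * B)                               ≈⟨ +-congˡ (+-cong (zeroˡ s) (zeroˡ B)) ⟩
    n + (0# + 0#)                                       ≈⟨ +-congˡ (+-identityˡ 0#) ⟩
    n + 0#                                              ≈⟨ +-identityʳ n ⟩
    n                                                   ∎
    where
      x = B′ * u
      y = B′ * v * t

open import Data.Fin using (Fin; toℕ; fromℕ<)
open import Data.Fin.Properties using (toℕ<n; toℕ-injective; toℕ-fromℕ<)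
open import Data.Integer as ℤ using (ℤ; +_; 0ℤ; 1ℤ; -1ℤ; _+_; _*_; -_; _≟_)
import Data.Integer.Properties as ℤ
open import Data.List using (List; []; _∷_; map; filter; replicate; _++_; allFin)
open import Data.List.Properties using (map-∘; map-cong; map-++; partition-defn)
open import Data.List.Membership.Propositional using (_∈_)
open import Data.List.Membership.Propositional.Properties
  using (∈-filter⁺; ∈-filter⁻; ∈-allFin; ∈-map∘filter⁻; ∈-map∘filter⁺)
open import Data.List.Membership.Propositional.Properties.WithK using (unique∧set⇒bag)
open import Data.List.Relation.Binary.BagAndSetEquality using (∼bag⇒↭)
open import Data.List.Relation.Binary.Permutation.Propositional using (_↭_; ↭-trans; ↭ₛ⇒↭; ↭⇒↭ₛ′)
import Data.List.Relation.Binary.Permutation.Propositional.Properties as ↭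
import Data.List.Relation.Binary.Permutation.Setoid.Properties as ↭ₛ
open import Data.List.Relation.Unary.All as All using (All; []; _∷_; all?)
import Data.List.Relation.Unary.All.Properties as All
open import Data.List.Relation.Unary.AllPairs using (AllPairs; []; _∷_)
open import Data.List.Relation.Unary.Any using (here; there)
open import Data.List.Relation.Unary.Unique.Propositional using (Unique)
import Data.List.Relation.Unary.Unique.Propositional.Properties as Unique
open import Data.Nat.Divisibility
  using (_∣_; _∤_; _∣?_; _∣0; divides; ∣-refl; ∣-trans; ∣-antisym; ∣⇒≤; 0∣⇒≡0; m∣m*n; n∣m*n;
         ∣m∣n⇒∣m+n; ∣m+n∣m⇒∣n; *-monoˡ-∣)
open import Data.Nat.GCD using (gcd[m,n]∣m; gcd[m,n]∣n; gcd-GCD; module Bézout)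
open import Data.Nat.Induction using (<-rec; <-wellFounded)
open import Data.Nat.Primality using (Prime; euclidsLemma; prime⇒nonZero; prime⇒nonTrivial)
import Data.Nat.Properties as ℕ
import Algebra.Properties.CommutativeSemigroup ℕ.*-commutativeSemigroup as ℕ*
open import Data.Sum using (_⊎_; inj₁; inj₂)
open import Function using (_∘_; mk⇔)
open import Induction.WellFounded using (module FixPoint)
open import Level using (0ℓ)
open import Relation.Binary.Definitions using (tri<; tri≈; tri>)
open import Relation.Binary.PropositionalEquality
open import Relation.Binary.Structures using (IsEquivalence)
open import Relation.Nullary using (Dec; yes; no; contradiction)
open import Relation.Unary.Properties using (∁?)

-- The ring of integer polynomials, up to equality of coefficients.

infix 4 _≈_
-- A record rather than a plain function type, so that both sides can be inferred.
record _≈_ (f g : Poly) : Set where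
  constructor coeffwise
  field coeff-≡ : ∀ k → coeff f k ≡ coeff g k
open _≈_

≈-isEquivalence : IsEquivalence _≈_
≈-isEquivalence = record
  { refl  = coeffwise λ _ → refl
  ; sym   = λ (coeffwise eq) → coeffwise λ k → sym (eq k)
  ; trans = λ (coeffwise eq) (coeffwise eq′) → coeffwise λ k → trans (eq k) (eq′ k)
  }
open IsEquivalence ≈-isEquivalence using () renaming (refl to ≈-refl; sym to ≈-sym; trans to ≈-trans)

coeff-⊕ : ∀ f g k → coeff (f ⊕ g) k ≡ coeff f k + coeff g k
coeff-⊕ []      g       k       = sym (ℤ.+-identityˡ _)
coeff-⊕ (x ∷ f) []      k       = sym (ℤ.+-identityʳ _)
coeff-⊕ (x ∷ f) (y ∷ g) zero    = refl
coeff-⊕ (x ∷ f) (y ∷ g) (suc k) = coeff-⊕ f g k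

coeff-· : ∀ c f k → coeff (c · f) k ≡ c * coeff f k
coeff-· c []      k       = sym (ℤ.*-zeroʳ c)
coeff-· c (x ∷ f) zero    = refl
coeff-· c (x ∷ f) (suc k) = coeff-· c f k

⊕-cong : ∀ {f f′ g g′} → f ≈ f′ → g ≈ g′ → f ⊕ g ≈ f′ ⊕ g′
⊕-cong {f} {f′} {g} {g′} (coeffwise p) (coeffwise q) = coeffwise λ k →
  trans (coeff-⊕ f g k) (trans (cong₂ _+_ (p k) (q k)) (sym (coeff-⊕ f′ g′ k)))

·-congˡ : ∀ c {f g} → f ≈ g → c · f ≈ c · g
·-congˡ c {f} {g} (coeffwise p) = coeffwise λ k →
  trans (coeff-· c f k) (trans (cong (c *_) (p k)) (sym (coeff-· c g k)))

∷-cong : ∀ {x y f g} → x ≡ y → f ≈ g → x ∷ f ≈ y ∷ g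
∷-cong x≡y (coeffwise p) = coeffwise λ { zero → x≡y ; (suc k) → p k }

⊕-assoc : ∀ f g h → (f ⊕ g) ⊕ h ≈ f ⊕ (g ⊕ h)
⊕-assoc f g h = coeffwise λ k → begin
  coeff ((f ⊕ g) ⊕ h) k                ≡⟨ coeff-⊕ (f ⊕ g) h k ⟩
  coeff (f ⊕ g) k + coeff h k          ≡⟨ cong (_+ coeff h k) (coeff-⊕ f g k) ⟩
  coeff f k + coeff g k + coeff h k    ≡⟨ ℤ.+-assoc (coeff f k) (coeff g k) (coeff h k) ⟩
  coeff f k + (coeff g k + coeff h k)  ≡⟨ cong (λ z → coeff f k + z) (coeff-⊕ g h k) ⟨
  coeff f k + coeff (g ⊕ h) k          ≡⟨ coeff-⊕ f (g ⊕ h) k ⟨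
  coeff (f ⊕ (g ⊕ h)) k                ∎
  where open ≡-Reasoning

⊕-comm : ∀ f g → f ⊕ g ≈ g ⊕ f
⊕-comm f g = coeffwise λ k →
  trans (coeff-⊕ f g k) (trans (ℤ.+-comm (coeff f k) (coeff g k)) (sym (coeff-⊕ g f k)))

⊕-identityʳ : ∀ f → f ⊕ [] ≈ f
⊕-identityʳ f = ⊕-comm f []

⊕-inverseʳ : ∀ f → f ⊕ -1ℤ · f ≈ []
⊕-inverseʳ f = coeffwise λ k → begin
  coeff (f ⊕ -1ℤ · f) k           ≡⟨ coeff-⊕ f (-1ℤ · f) k ⟩
  coeff f k + coeff (-1ℤ · f) k   ≡⟨ cong (λ z → coeff f k + z) (trans (coeff-· -1ℤ f k) (ℤ.-1*i≡-i _)) ⟩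
  coeff f k + ℤ.- coeff f k       ≡⟨ ℤ.+-inverseʳ (coeff f k) ⟩
  0ℤ                              ∎
  where open ≡-Reasoning

·-⊕ : ∀ c f g → c · (f ⊕ g) ≈ c · f ⊕ c · g
·-⊕ c f g = coeffwise λ k → begin
  coeff (c · (f ⊕ g)) k                  ≡⟨ coeff-· c (f ⊕ g) k ⟩
  c * coeff (f ⊕ g) k                    ≡⟨ cong (c *_) (coeff-⊕ f g k) ⟩
  c * (coeff f k + coeff g k)            ≡⟨ ℤ.*-distribˡ-+ c (coeff f k) (coeff g k) ⟩
  c * coeff f k + c * coeff g k          ≡⟨ cong₂ _+_ (coeff-· c f k) (coeff-· c g k) ⟨
  coeff (c · f) k + coeff (c · g) k      ≡⟨ coeff-⊕ (c · f) (c · g) k ⟨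
  coeff (c · f ⊕ c · g) k                ∎
  where open ≡-Reasoning

+-· : ∀ c d f → (c + d) · f ≈ c · f ⊕ d · f
+-· c d f = coeffwise λ k → begin
  coeff ((c + d) · f) k                  ≡⟨ coeff-· (c + d) f k ⟩
  (c + d) * coeff f k                    ≡⟨ ℤ.*-distribʳ-+ (coeff f k) c d ⟩
  c * coeff f k + d * coeff f k          ≡⟨ cong₂ _+_ (coeff-· c f k) (coeff-· d f k) ⟨
  coeff (c · f) k + coeff (d · f) k      ≡⟨ coeff-⊕ (c · f) (d · f) k ⟨
  coeff (c · f ⊕ d · f) k                ∎
  where open ≡-Reasoning

·-· : ∀ c d f → c · (d · f) ≈ (c * d) · f
·-· c d f = coeffwise λ k → begin
  coeff (c · (d · f)) k    ≡⟨ coeff-· c (d · f) k ⟩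
  c * coeff (d · f) k      ≡⟨ cong (c *_) (coeff-· d f k) ⟩
  c * (d * coeff f k)      ≡⟨ ℤ.*-assoc c d (coeff f k) ⟨
  c * d * coeff f k        ≡⟨ coeff-· (c * d) f k ⟨
  coeff ((c * d) · f) k    ∎
  where open ≡-Reasoning

0· : ∀ f → 0ℤ · f ≈ []
0· f = coeffwise λ k → coeff-· 0ℤ f k

1· : ∀ f → 1ℤ · f ≈ f
1· f = coeffwise λ k → trans (coeff-· 1ℤ f k) (ℤ.*-identityˡ _)

0∷[] : 0ℤ ∷ [] ≈ []
0∷[] = coeffwise λ { zero → refl ; (suc k) → refl }

⊕-commutativeMonoid : CommutativeMonoid 0ℓ 0ℓ
⊕-commutativeMonoid = record
  { Carrier = Poly ; _≈_ = _≈_ ; _∙_ = _⊕_ ; ε = []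
  ; isCommutativeMonoid = record
    { isMonoid = record
      { isSemigroup = record
        { isMagma = record { isEquivalence = ≈-isEquivalence ; ∙-cong = ⊕-cong }
        ; assoc = ⊕-assoc }
      ; identity = (λ f → ≈-refl) , ⊕-identityʳ }
    ; comm = ⊕-comm } }

private module ⊕ = CommutativeMonoid ⊕-commutativeMonoid
open import Algebra.Properties.CommutativeSemigroup ⊕.commutativeSemigroup using (interchange; x∙yz≈y∙xz)
import Relation.Binary.Reasoning.Setoid ⊕.setoid as ≈-Reasoning

⊗-zeroʳ : ∀ f → f ⊗ [] ≈ []
⊗-zeroʳ []      = ≈-refl
⊗-zeroʳ (x ∷ f) = ≈-trans (∷-cong refl (⊗-zeroʳ f)) 0∷[]

⊗-congˡ : ∀ f {g g′} → g ≈ g′ → f ⊗ g ≈ f ⊗ g′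
⊗-congˡ []      p = ≈-refl
⊗-congˡ (x ∷ f) p = ⊕-cong (·-congˡ x p) (∷-cong refl (⊗-congˡ f p))

-- The recursion of `_⊗_` mirrored in the second factor; commutativity follows from it by induction.
⊗-∷ : ∀ f y g → f ⊗ (y ∷ g) ≈ y · f ⊕ (0ℤ ∷ f ⊗ g)
⊗-∷ []      y g = ≈-sym 0∷[]
⊗-∷ (x ∷ f) y g = ∷-cong (cong (_+ 0ℤ) (ℤ.*-comm x y)) (begin
  x · g ⊕ f ⊗ (y ∷ g)               ≈⟨ ⊕-cong ≈-refl (⊗-∷ f y g) ⟩
  x · g ⊕ (y · f ⊕ (0ℤ ∷ f ⊗ g))    ≈⟨ x∙yz≈y∙xz (x · g) (y · f) _ ⟩
  y · f ⊕ (x · g ⊕ (0ℤ ∷ f ⊗ g))    ∎)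
  where open ≈-Reasoning

⊗-comm : ∀ f g → f ⊗ g ≈ g ⊗ f
⊗-comm []      g = ≈-sym (⊗-zeroʳ g)
⊗-comm (x ∷ f) g = begin
  x · g ⊕ (0ℤ ∷ f ⊗ g)  ≈⟨ ⊕-cong ≈-refl (∷-cong refl (⊗-comm f g)) ⟩
  x · g ⊕ (0ℤ ∷ g ⊗ f)  ≈⟨ ⊗-∷ g x f ⟨
  g ⊗ (x ∷ f)           ∎
  where open ≈-Reasoning

-- Equal polynomials may be lists of different lengths, which makes induction on the first factor
-- awkward; commutativity moves the change to the second factor.
⊗-cong : ∀ {f f′ g g′} → f ≈ f′ → g ≈ g′ → f ⊗ g ≈ f′ ⊗ g′
⊗-cong {f} {f′} {g} {g′} p q = begin
  f ⊗ g    ≈⟨ ⊗-congˡ f q ⟩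
  f ⊗ g′   ≈⟨ ⊗-comm f g′ ⟩
  g′ ⊗ f   ≈⟨ ⊗-congˡ g′ p ⟩
  g′ ⊗ f′  ≈⟨ ⊗-comm g′ f′ ⟩
  f′ ⊗ g′  ∎
  where open ≈-Reasoning

⊗-distribˡ : ∀ f g h → f ⊗ (g ⊕ h) ≈ f ⊗ g ⊕ f ⊗ h
⊗-distribˡ []      g h = ≈-refl
⊗-distribˡ (x ∷ f) g h = begin
  x · (g ⊕ h) ⊕ (0ℤ ∷ f ⊗ (g ⊕ h))                  ≈⟨ ⊕-cong (·-⊕ x g h) (∷-cong refl (⊗-distribˡ f g h)) ⟩
  x · g ⊕ x · h ⊕ ((0ℤ ∷ f ⊗ g) ⊕ (0ℤ ∷ f ⊗ h))     ≈⟨ interchange (x · g) (x · h) (0ℤ ∷ f ⊗ g) (0ℤ ∷ f ⊗ h) ⟩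
  x · g ⊕ (0ℤ ∷ f ⊗ g) ⊕ (x · h ⊕ (0ℤ ∷ f ⊗ h))     ∎
  where open ≈-Reasoning

⊗-distribʳ : ∀ h f g → (f ⊕ g) ⊗ h ≈ f ⊗ h ⊕ g ⊗ h
⊗-distribʳ h f g = begin
  (f ⊕ g) ⊗ h    ≈⟨ ⊗-comm (f ⊕ g) h ⟩
  h ⊗ (f ⊕ g)    ≈⟨ ⊗-distribˡ h f g ⟩
  h ⊗ f ⊕ h ⊗ g  ≈⟨ ⊕-cong (⊗-comm h f) (⊗-comm h g) ⟩
  f ⊗ h ⊕ g ⊗ h  ∎
  where open ≈-Reasoning

·-⊗ : ∀ c f g → (c · f) ⊗ g ≈ c · (f ⊗ g)
·-⊗ c []      g = ≈-refl
·-⊗ c (x ∷ f) g = begin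
  (c * x) · g ⊕ (0ℤ ∷ (c · f) ⊗ g)      ≈⟨ ⊕-cong (≈-sym (·-· c x g)) (∷-cong (sym (ℤ.*-zeroʳ c)) (·-⊗ c f g)) ⟩
  c · (x · g) ⊕ c · (0ℤ ∷ f ⊗ g)        ≈⟨ ·-⊕ c (x · g) (0ℤ ∷ f ⊗ g) ⟨
  c · (x · g ⊕ (0ℤ ∷ f ⊗ g))            ∎
  where open ≈-Reasoning

⊗-assoc : ∀ f g h → (f ⊗ g) ⊗ h ≈ f ⊗ (g ⊗ h)
⊗-assoc []      g h = ≈-refl
⊗-assoc (x ∷ f) g h = begin
  (x · g ⊕ (0ℤ ∷ f ⊗ g)) ⊗ h                 ≈⟨ ⊗-distribʳ h (x · g) (0ℤ ∷ f ⊗ g) ⟩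
  (x · g) ⊗ h ⊕ (0ℤ · h ⊕ (0ℤ ∷ f ⊗ g ⊗ h))  ≈⟨ ⊕-cong (·-⊗ x g h) (⊕-cong (0· h) (∷-cong refl (⊗-assoc f g h))) ⟩
  x · (g ⊗ h) ⊕ (0ℤ ∷ f ⊗ (g ⊗ h))           ∎
  where open ≈-Reasoning

⊗-identityˡ : ∀ f → (1ℤ ∷ []) ⊗ f ≈ f
⊗-identityˡ f = begin
  1ℤ · f ⊕ (0ℤ ∷ [])  ≈⟨ ⊕-cong (1· f) 0∷[] ⟩
  f ⊕ []              ≈⟨ ⊕-identityʳ f ⟩
  f                   ∎
  where open ≈-Reasoning

ℤ[x] : CommutativeRing 0ℓ 0ℓ
ℤ[x] = record
  { Carrier = Poly ; _≈_ = _≈_ ; _+_ = _⊕_ ; _*_ = _⊗_ ; -_ = -1ℤ ·_ ; 0# = [] ; 1# = 1ℤ ∷ []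
  ; isCommutativeRing = record
    { isRing = record
      { +-isAbelianGroup = record
        { isGroup = record
          { isMonoid = ⊕.isMonoid
          ; inverse = (λ f → ≈-trans (⊕-comm (-1ℤ · f) f) (⊕-inverseʳ f)) , ⊕-inverseʳ
          ; ⁻¹-cong = ·-congˡ -1ℤ }
        ; comm = ⊕-comm }
      ; *-cong = ⊗-cong
      ; *-assoc = ⊗-assoc
      ; *-identity = ⊗-identityˡ , λ f → ≈-trans (⊗-comm f (1ℤ ∷ [])) (⊗-identityˡ f)
      ; distrib = ⊗-distribˡ , ⊗-distribʳ }
    ; *-comm = ⊗-comm } }

open CommutativeRing ℤ[x] using (ring; semiring; commutativeSemiring; +-group; *-isCommutativeMonoid)
open Exp semiring using (^-homo-*; ^-assocʳ; ^-congʳ) renaming (_^_ to _↑_)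
open Mult semiring using () renaming (_×_ to _⊠_)
open GroupProperties +-group using (∙-cancelˡ; x∙y⁻¹≈ε⇒x≈y)
open RingProperties ring using (-‿distribʳ-*)
open CommutativeRingIdentities ℤ[x]
open SemiringSolver commutativeSemiring using (solve; _:=_; _:+_; _:*_; con)

const : ℤ → Poly
const c = c ∷ []

const-⊗ : ∀ c f → const c ⊗ f ≈ c · f
const-⊗ c f = ≈-trans (⊕-cong ≈-refl 0∷[]) (⊕-identityʳ (c · f))

const-homo-* : ∀ c d → const c ⊗ const d ≈ const (c * d)
const-homo-* c d = const-⊗ c (const d)

⊠-const : ∀ n → n ⊠ const 1ℤ ≈ const (+ n)
⊠-const zero    = ≈-sym 0∷[]
⊠-const (suc n) = ⊕-cong (≈-refl {const 1ℤ}) (⊠-const n)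

-- Nonzero coefficients, leading terms and monic polynomials.

*-≢0 : ∀ {i j} → i ≢ 0ℤ → j ≢ 0ℤ → i * j ≢ 0ℤ
*-≢0 {i} i≢0 j≢0 ij≡0 with ℤ.i*j≡0⇒i≡0∨j≡0 i ij≡0
... | inj₁ i≡0 = i≢0 i≡0
... | inj₂ j≡0 = j≢0 j≡0

*-≢0⁻ : ∀ i j → i * j ≢ 0ℤ → i ≢ 0ℤ × j ≢ 0ℤ
*-≢0⁻ i j ij≢0 = (λ { refl → ij≢0 refl }) , (λ { refl → ij≢0 (ℤ.*-zeroʳ i) })

+-≢0⁻ : ∀ i j → i + j ≢ 0ℤ → i ≢ 0ℤ ⊎ j ≢ 0ℤ
+-≢0⁻ i j i+j≢0 with i ≟ 0ℤ
... | no i≢0   = inj₁ i≢0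
... | yes refl = inj₂ λ j≡0 → i+j≢0 (trans (ℤ.+-identityˡ j) j≡0)

-- The coefficient is the sum of the products with i + j = k, so one of these is nonzero. In this
-- form degree bounds and supports of products are read off without a convolution sum.
coeff-⊗-≢0 : ∀ f g k → coeff (f ⊗ g) k ≢ 0ℤ →
  ∃₂ λ i j → coeff f i ≢ 0ℤ × coeff g j ≢ 0ℤ × i ℕ.+ j ≡ k
coeff-⊗-≢0 []      g k       ≢0 = contradiction refl ≢0
coeff-⊗-≢0 (x ∷ f) g k       ≢0
  with +-≢0⁻ (coeff (x · g) k) (coeff (0ℤ ∷ f ⊗ g) k) (≢0 ∘ trans (coeff-⊕ (x · g) (0ℤ ∷ f ⊗ g) k))
... | inj₁ xg≢0 =
  let x≢0 , g≢0 = *-≢0⁻ x (coeff g k) (xg≢0 ∘ trans (coeff-· x g k))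
  in 0 , k , x≢0 , g≢0 , refl
coeff-⊗-≢0 (x ∷ f) g zero    ≢0 | inj₂ 0≢0 = contradiction refl 0≢0
coeff-⊗-≢0 (x ∷ f) g (suc k) ≢0 | inj₂ fg≢0 =
  let i , j , f≢0 , g≢0 , i+j≡k = coeff-⊗-≢0 f g k fg≢0
  in suc i , j , f≢0 , g≢0 , cong suc i+j≡k

-- c may be zero, so this bounds the degree by n and names the coefficient there.
record Leading (f : Poly) (n : ℕ) (c : ℤ) : Set where
  constructor leading
  field
    coeff-top   : coeff f n ≡ c
    coeff-above : ∀ {k} → n < k → coeff f k ≡ 0ℤ
open Leading

Monic : Poly → Set
Monic f = ∃ λ n → Leading f n 1ℤ

leading-resp-≈ : ∀ {f g n c} → f ≈ g → Leading f n c → Leading g n c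
leading-resp-≈ (coeffwise eq) (leading fn≡c above) =
  leading (trans (sym (eq _)) fn≡c) λ n<k → trans (sym (eq _)) (above n<k)

monic-resp-≈ : ∀ {f g} → f ≈ g → Monic f → Monic g
monic-resp-≈ f≈g (n , lf) = n , leading-resp-≈ f≈g lf

-- `degree` is 0 both for the zero polynomial and for nonzero constants, so degree comparisons split
-- on this alternative instead.
≈[]⊎leading : ∀ f → f ≈ [] ⊎ (∃₂ λ n c → c ≢ 0ℤ × Leading f n c)
≈[]⊎leading []      = inj₁ ≈-refl
≈[]⊎leading (x ∷ f) with ≈[]⊎leading f | x ≟ 0ℤ
... | inj₂ (n , c , c≢0 , leading fn≡c above) | _ =
  inj₂ (suc n , c , c≢0 , leading fn≡c λ { (s<s n<k) → above n<k })
... | inj₁ f≈[] | yes x≡0 = inj₁ (≈-trans (∷-cong x≡0 f≈[]) 0∷[])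
... | inj₁ f≈[] | no x≢0  = inj₂ (0 , x , x≢0 , leading refl λ { (s<s _) → coeff-≡ f≈[] _ })

leading-unique : ∀ {f m n b c} → b ≢ 0ℤ → c ≢ 0ℤ → Leading f m b → Leading f n c → m ≡ n × b ≡ c
leading-unique {f} {m} {n} b≢0 c≢0 (leading fm≡b above-m) (leading fn≡c above-n) with ℕ.<-cmp m n
... | tri< m<n _ _  = contradiction (trans (sym fn≡c) (above-m m<n)) c≢0
... | tri≈ _ refl _ = refl , trans (sym fm≡b) fn≡c
... | tri> _ _ n<m  = contradiction (trans (sym fm≡b) (above-n n<m)) b≢0

leading-⊗ : ∀ {f g m n b c} → Leading f m b → Leading g n c → Leading (f ⊗ g) (m ℕ.+ n) (b * c)
leading-⊗ {f} {g} {m} {n} {b} {c} lf@(leading fm≡b above-f) (leading gn≡c above-g) = leading (top f m lf) above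
  where
  open ≡-Reasoning
  above : ∀ {k} → m ℕ.+ n < k → coeff (f ⊗ g) k ≡ 0ℤ
  above {k} m+n<k with coeff (f ⊗ g) k ≟ 0ℤ
  ... | yes ≡0 = ≡0
  ... | no ≢0 with i , j , fi≢0 , gj≢0 , refl ← coeff-⊗-≢0 f g k ≢0 =
    contradiction
      (ℕ.+-mono-≤ (ℕ.≮⇒≥ (fi≢0 ∘ above-f)) (ℕ.≮⇒≥ (gj≢0 ∘ above-g)))
      (ℕ.<⇒≱ m+n<k)

  top : ∀ f m → Leading f m b → coeff (f ⊗ g) (m ℕ.+ n) ≡ b * c
  top []      m       (leading refl _)     = refl
  -- A degree bound of 0 makes the tail `f` zero, so only `x · g` is left.
  top (x ∷ f) zero    (leading refl above-f) = begin
    coeff (x · g ⊕ (0ℤ ∷ f ⊗ g)) n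
      ≡⟨ coeff-≡ (⊕-cong (≈-refl {x · g}) (≈-trans (∷-cong refl (⊗-cong f≈[] (≈-refl {g}))) 0∷[])) n ⟩
    coeff (x · g ⊕ []) n            ≡⟨ coeff-≡ (⊕-identityʳ (x · g)) n ⟩
    coeff (x · g) n                 ≡⟨ coeff-· x g n ⟩
    x * coeff g n                   ≡⟨ cong (x *_) gn≡c ⟩
    x * c                           ∎
    where
    f≈[] : f ≈ []
    f≈[] = coeffwise λ k → above-f z<s
  -- The index exceeds the degree bound of `g`, so `x · g` contributes nothing and the tail decides.
  top (x ∷ f) (suc m) (leading fm≡b above-f) = begin
    coeff (x · g ⊕ (0ℤ ∷ f ⊗ g)) (suc m ℕ.+ n)         ≡⟨ coeff-⊕ (x · g) (0ℤ ∷ f ⊗ g) (suc m ℕ.+ n) ⟩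
    coeff (x · g) (suc m ℕ.+ n) + coeff (f ⊗ g) (m ℕ.+ n)
      ≡⟨ cong₂ _+_ (coeff-· x g (suc m ℕ.+ n)) (top f m (leading fm≡b (above-f ∘ s<s))) ⟩
    x * coeff g (suc m ℕ.+ n) + b * c                  ≡⟨ cong (λ z → x * z + b * c) (above-g (s≤s (ℕ.m≤n+m n m))) ⟩
    x * 0ℤ + b * c                                     ≡⟨ cong (_+ b * c) (ℤ.*-zeroʳ x) ⟩
    0ℤ + b * c                                         ≡⟨ ℤ.+-identityˡ (b * c) ⟩
    b * c                                              ∎

monic-⊗ : ∀ {f g} → Monic f → Monic g → Monic (f ⊗ g)
monic-⊗ (m , lf) (n , lg) = m ℕ.+ n , leading-⊗ lf lg

monic-∏ : ∀ {fs} → All Monic fs → Monic (∏ fs)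
monic-∏ []       = 0 , leading refl λ { (s<s _) → refl }
monic-∏ (m ∷ ms) = monic-⊗ m (monic-∏ ms)

-- Leading coefficients multiply, so that of `f` times 1 equals 1.
monic-factor : ∀ {f g} → Monic (f ⊗ g) → Monic g → Monic f
monic-factor {f} {g} (m , lfg) (n , lg) with ≈[]⊎leading f
... | inj₁ f≈[] = contradiction (trans (sym (coeff-top lfg)) (coeff-≡ (⊗-cong f≈[] (≈-refl {g})) m)) λ ()
... | inj₂ (k , c , c≢0 , lf) = k , subst (Leading f k) c≡1 lf
  where
  c*1≡1 = proj₂ (leading-unique (*-≢0 c≢0 λ ()) (λ ()) (leading-⊗ lf lg) lfg)
  c≡1 = trans (sym (ℤ.*-identityʳ c)) c*1≡1

monic-⊗-zero : ∀ f {g} → Monic g → f ⊗ g ≈ [] → f ≈ []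
monic-⊗-zero f (n , lg) fg≈[] with ≈[]⊎leading f
... | inj₁ f≈[] = f≈[]
... | inj₂ (k , c , c≢0 , lf) = contradiction
  (trans (sym (coeff-top (leading-⊗ lf lg))) (coeff-≡ fg≈[] (k ℕ.+ n))) (*-≢0 c≢0 λ ())

-- Ties the `degree` consulted by `divMod` to `Leading`; `c ≢ 0ℤ` makes the bound `n` exact.
degree-leading : ∀ f {n c} → c ≢ 0ℤ → Leading f n c → degree f ≡ n
degree-leading []      c≢0 (leading refl _) = contradiction refl c≢0
degree-leading (x ∷ f) c≢0 (leading fn≡c above) with all? (_≟ 0ℤ) f
degree-leading (x ∷ f) {zero}  c≢0 (leading fn≡c above) | yes f≡0 = refl
degree-leading (x ∷ f) {suc n} c≢0 (leading fn≡c above) | yes f≡0 =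
  contradiction (trans (sym fn≡c) (coeff-all-0 f≡0 n)) c≢0
  where
  coeff-all-0 : ∀ {f} → All (_≡ 0ℤ) f → ∀ k → coeff f k ≡ 0ℤ
  coeff-all-0 []       k       = refl
  coeff-all-0 (eq ∷ _) zero    = eq
  coeff-all-0 (_ ∷ eqs) (suc k) = coeff-all-0 eqs k
degree-leading (x ∷ f) {zero}  c≢0 (leading fn≡c above) | no f≢0 =
  contradiction (all-0 f (λ k → above z<s)) f≢0
  where
  all-0 : ∀ f → (∀ k → coeff f k ≡ 0ℤ) → All (_≡ 0ℤ) f
  all-0 []      eq = []
  all-0 (x ∷ f) eq = eq 0 ∷ all-0 f (eq ∘ suc)
degree-leading (x ∷ f) {suc n} c≢0 (leading fn≡c above) | no _ =
  cong suc (degree-leading f c≢0 (leading fn≡c (above ∘ s<s)))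

-- Long division by monic polynomials.

_rem_ : Poly → Poly → Poly
f rem d = proj₂ (divMod f d)

-- Each division step adds `c · d` on the side of the quotient and subtracts it from the remainder,
-- which preserves the identity whatever the value of `c`.
divMod-≈ : ∀ f d → f ≈ (f quot d) ⊗ d ⊕ f rem d
divMod-≈ []      d = ≈-refl
divMod-≈ (x ∷ f) d = ≈-sym (begin
  c · d ⊕ (0ℤ ∷ q ⊗ d) ⊕ ((x ∷ r) ⊕ (- c) · d)
    ≈⟨ solve 4 (λ cd xqd xr -cd → cd :+ xqd :+ (xr :+ -cd) := (cd :+ -cd) :+ (xqd :+ xr)) ≈-refl
         (c · d) (0ℤ ∷ q ⊗ d) (x ∷ r) ((- c) · d) ⟩
  (c · d ⊕ (- c) · d) ⊕ ((0ℤ ∷ q ⊗ d) ⊕ (x ∷ r))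
    ≈⟨ ⊕-cong (≈-sym (+-· c (- c) d)) (∷-cong (ℤ.+-identityˡ x) (≈-sym (divMod-≈ f d))) ⟩
  (c + - c) · d ⊕ (x ∷ f)
    ≡⟨ cong (λ z → z · d ⊕ (x ∷ f)) (ℤ.+-inverseʳ c) ⟩
  0ℤ · d ⊕ (x ∷ f)
    ≈⟨ ⊕-cong (0· d) ≈-refl ⟩
  x ∷ f ∎)
  where
  open ≈-Reasoning
  q = f quot d
  r = f rem d
  c = coeff (x ∷ r) (degree d)

coeff-rem : ∀ f d {n} → Leading d n 1ℤ → ∀ {k} → n ≤ k → coeff (f rem d) k ≡ 0ℤ
coeff-rem []      d     ld           n≤k = refl
coeff-rem (x ∷ f) d {n} ld@(leading dn≡1 above) {k} n≤k = begin
  coeff ((x ∷ r) ⊕ (- c) · d) k               ≡⟨ coeff-⊕ (x ∷ r) ((- c) · d) k ⟩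
  coeff (x ∷ r) k + coeff ((- c) · d) k       ≡⟨ cong (λ z → coeff (x ∷ r) k + z) (coeff-· (- c) d k) ⟩
  coeff (x ∷ r) k + - c * coeff d k           ≡⟨ cancel (ℕ.m≤n⇒m<n∨m≡n n≤k) ⟩
  0ℤ                                          ∎
  where
  open ≡-Reasoning
  r = f rem d
  c = coeff (x ∷ r) (degree d)
  cancel : ∀ {k} → n < k ⊎ n ≡ k → coeff (x ∷ r) k + - c * coeff d k ≡ 0ℤ
  -- Prepending `x` shifts `r` by one, so the coefficient in question is that of `r` at an index
  -- still at least `n`.
  cancel {suc k} (inj₁ n<k@(s≤s n≤k)) =
    trans (cong₂ (λ y z → y + - c * z) (coeff-rem f d ld n≤k) (above n<k)) (trans (ℤ.+-identityˡ _) (ℤ.*-zeroʳ (- c)))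
  -- At the degree of `d` the choice of `c` pays off: `d` has coefficient 1 there.
  cancel (inj₂ refl) rewrite degree-leading d (λ ()) ld | dn≡1 =
    trans (cong (λ z → c′ + z) (ℤ.*-identityʳ (- c′))) (ℤ.+-inverseʳ c′)
    where c′ = coeff (x ∷ r) n

-- If N f = h d and f = q d + r with deg r < deg d, then (h - N q) d = N r has degree
-- below deg d, hence h = N q and N r = 0.
quot-exact : ∀ {N f d h} → N ≢ 0ℤ → Monic d → h ⊗ d ≈ const N ⊗ f → (f quot d) ⊗ d ≈ f
quot-exact {N} {f} {d} {h} N≢0 (n , ld) hd≈Nf = ≈-sym (begin
  f                    ≈⟨ divMod-≈ f d ⟩
  q ⊗ d ⊕ r            ≈⟨ ⊕-cong ≈-refl r≈[] ⟩
  q ⊗ d ⊕ []           ≈⟨ ⊕-identityʳ (q ⊗ d) ⟩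
  q ⊗ d                ∎)
  where
  open ≈-Reasoning
  q = f quot d
  r = f rem d
  w = h ⊕ -1ℤ · (N · q)

  wd≈Nr : w ⊗ d ≈ N · r
  wd≈Nr = begin
    (h ⊕ -1ℤ · (N · q)) ⊗ d                      ≈⟨ ⊗-distribʳ d h _ ⟩
    h ⊗ d ⊕ (-1ℤ · (N · q)) ⊗ d                  ≈⟨ ⊕-cong hd≈ (·-⊗ -1ℤ (N · q) d) ⟩
    (N · q ⊗ d ⊕ N · r) ⊕ -1ℤ · ((N · q) ⊗ d)    ≈⟨ ⊕-cong (⊕-comm ((N · q) ⊗ d) (N · r)) ≈-refl ⟩
    (N · r ⊕ N · q ⊗ d) ⊕ -1ℤ · ((N · q) ⊗ d)    ≈⟨ ⊕-assoc (N · r) ((N · q) ⊗ d) _ ⟩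
    N · r ⊕ ((N · q) ⊗ d ⊕ -1ℤ · ((N · q) ⊗ d))  ≈⟨ ⊕-cong ≈-refl (⊕-inverseʳ ((N · q) ⊗ d)) ⟩
    N · r ⊕ []                                   ≈⟨ ⊕-identityʳ (N · r) ⟩
    N · r                                        ∎
    where
    hd≈ : h ⊗ d ≈ (N · q) ⊗ d ⊕ N · r
    hd≈ = begin
      h ⊗ d                      ≈⟨ hd≈Nf ⟩
      const N ⊗ f                ≈⟨ const-⊗ N f ⟩
      N · f                      ≈⟨ ·-congˡ N (divMod-≈ f d) ⟩
      N · (q ⊗ d ⊕ r)            ≈⟨ ·-⊕ N (q ⊗ d) r ⟩
      N · (q ⊗ d) ⊕ N · r        ≈⟨ ⊕-cong (≈-sym (·-⊗ N q d)) ≈-refl ⟩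
      (N · q) ⊗ d ⊕ N · r        ∎

  Nr-high : ∀ {k} → n ≤ k → coeff (N · r) k ≡ 0ℤ
  Nr-high {k} n≤k = trans (coeff-· N r k) (trans (cong (N *_) (coeff-rem f d ld n≤k)) (ℤ.*-zeroʳ N))

  w≈[] : w ≈ []
  w≈[] with ≈[]⊎leading w
  ... | inj₁ w≈[] = w≈[]
  ... | inj₂ (k , c , c≢0 , lw) = contradiction
    (trans (sym (coeff-top (leading-⊗ lw ld))) (trans (coeff-≡ wd≈Nr (k ℕ.+ n)) (Nr-high (ℕ.m≤n+m n k))))
    (*-≢0 c≢0 λ ())

  r≈[] : r ≈ []
  r≈[] = coeffwise λ k → cancel k (trans (sym (coeff-· N r k))
    (coeff-≡ (≈-trans (≈-sym wd≈Nr) (⊗-cong w≈[] (≈-refl {d}))) k))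
    where
    cancel : ∀ k → N * coeff r k ≡ 0ℤ → coeff r k ≡ 0ℤ
    cancel k eq with ℤ.i*j≡0⇒i≡0∨j≡0 N eq
    ... | inj₁ N≡0 = contradiction N≡0 N≢0
    ... | inj₂ ≡0  = ≡0

-- Polynomials whose exponents are multiples of p.

-- All exponents of xⁱ f are multiples of p; the shift i makes this inductive in the list f.
Supported : ℕ → ℕ → Poly → Set
Supported p i f = ∀ k → coeff f k ≢ 0ℤ → p ∣ i ℕ.+ k

supported-resp-≈ : ∀ {p i f g} → f ≈ g → Supported p i f → Supported p i g
supported-resp-≈ (coeffwise eq) sf k gk≢0 = sf k (gk≢0 ∘ trans (sym (eq k)))

supported-⊗ : ∀ {p f g} → Supported p 0 f → Supported p 0 g → Supported p 0 (f ⊗ g)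
supported-⊗ {f = f} {g} sf sg k ≢0 with i , j , fi≢0 , gj≢0 , refl ← coeff-⊗-≢0 f g k ≢0 =
  ∣m∣n⇒∣m+n (sf i fi≢0) (sg j gj≢0)

supported-∏ : ∀ {p fs} → All (Supported p 0) fs → Supported p 0 (∏ fs)
supported-∏ {p} [] zero    _  = p ∣0
supported-∏     [] (suc k) ≢0 = contradiction refl ≢0
supported-∏ {p} {f ∷ fs} (sf ∷ sfs) = supported-⊗ {p} {f} {∏ fs} sf (supported-∏ sfs)

supported-∷ : ∀ {p i x f} → (x ≢ 0ℤ → p ∣ i) → Supported p (suc i) f → Supported p i (x ∷ f)
supported-∷ {p} {i} x⇒ sf zero    x≢0 = subst (p ∣_) (sym (ℕ.+-identityʳ i)) (x⇒ x≢0)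
supported-∷ {p} {i} x⇒ sf (suc k) ≢0  = subst (p ∣_) (sym (ℕ.+-suc i k)) (sf k ≢0)

-- If the new quotient entry `c` is nonzero, then p divides i + n, as `c` is the coefficient of
-- `x ∷ r` at n = deg d. The monic `d` has a nonzero coefficient at n, so p divides n and hence i.
-- This settles both the entry `c` and the subtracted multiple of `d`.
supported-divMod : ∀ {p i d n} → Leading d n 1ℤ → Supported p 0 d → ∀ f → Supported p i f →
  Supported p i (f quot d) × Supported p i (f rem d)
supported-divMod ld sd [] sf = sf , sf
supported-divMod {p} {i} {d} {n} ld sd (x ∷ f) sf =
  supported-∷ c⇒ sq , remainder
  where
  sf′ : Supported p (suc i) f
  sf′ k ≢0 = subst (p ∣_) (ℕ.+-suc i k) (sf (suc k) ≢0)
  sq = proj₁ (supported-divMod ld sd f sf′)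
  r = f rem d
  c = coeff (x ∷ r) (degree d)
  sxr : Supported p i (x ∷ r)
  sxr = supported-∷ (subst (p ∣_) (ℕ.+-identityʳ i) ∘ sf 0) (proj₂ (supported-divMod ld sd f sf′))
  p∣n : p ∣ n
  p∣n = sd n (λ eq → contradiction (trans (sym (coeff-top ld)) eq) λ ())
  c⇒ : c ≢ 0ℤ → p ∣ i
  c⇒ c≢0 = ∣m+n∣m⇒∣n (subst (p ∣_) (trans (cong (i ℕ.+_) (degree-leading d (λ ()) ld)) (ℕ.+-comm i n)) (sxr (degree d) c≢0)) p∣n
  remainder : Supported p i ((x ∷ r) ⊕ (- c) · d)
  remainder k ≢0 with +-≢0⁻ (coeff (x ∷ r) k) (coeff ((- c) · d) k) (≢0 ∘ trans (coeff-⊕ (x ∷ r) ((- c) · d) k))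
  ... | inj₁ ≢0′ = sxr k ≢0′
  ... | inj₂ ≢0′ =
    let -c≢0 , dk≢0 = *-≢0⁻ (- c) (coeff d k) (≢0′ ∘ trans (coeff-· (- c) d k))
    in ∣m∣n⇒∣m+n (c⇒ (-c≢0 ∘ cong -_)) (sd k dk≢0)

-- Comaximal polynomials and divisibility by their product.

-- Coprimality over ℚ with denominators cleared.
Comaximal : Poly → Poly → Set
Comaximal f g = ∃ λ N → N ≢ 0ℤ × ∃₂ λ u v → u ⊗ f ⊕ v ⊗ g ≈ const N

comaximal-sym : ∀ {f g} → Comaximal f g → Comaximal g f
comaximal-sym {f} {g} (N , N≢0 , u , v , eq) = N , N≢0 , v , u , ≈-trans (⊕-comm (v ⊗ g) (u ⊗ f)) eq

-- Multiply the two relations: every term of the product contains f, except v v′ g h.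
comaximal-⊗ : ∀ {f g h} → Comaximal f g → Comaximal f h → Comaximal f (g ⊗ h)
comaximal-⊗ {f} {g} {h} (M , M≢0 , u , v , eq) (N , N≢0 , u′ , v′ , eq′) =
  M * N , *-≢0 M≢0 N≢0 , u ⊗ u′ ⊗ f ⊕ u ⊗ v′ ⊗ h ⊕ v ⊗ g ⊗ u′ , v ⊗ v′ , (begin
    (u ⊗ u′ ⊗ f ⊕ u ⊗ v′ ⊗ h ⊕ v ⊗ g ⊗ u′) ⊗ f ⊕ v ⊗ v′ ⊗ (g ⊗ h)
      ≈⟨ solve 7 (λ f g h u v u′ v′ →
           (u :* u′ :* f :+ u :* v′ :* h :+ v :* g :* u′) :* f :+ v :* v′ :* (g :* h)
           := (u :* f :+ v :* g) :* (u′ :* f :+ v′ :* h)) ≈-refl f g h u v u′ v′ ⟩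
    (u ⊗ f ⊕ v ⊗ g) ⊗ (u′ ⊗ f ⊕ v′ ⊗ h)  ≈⟨ ⊗-cong eq eq′ ⟩
    const M ⊗ const N                    ≈⟨ const-homo-* M N ⟩
    const (M * N)                        ∎)
  where open ≈-Reasoning

comaximal-∏ : ∀ {f gs} → All (Comaximal f) gs → Comaximal f (∏ gs)
comaximal-∏ {f} []  = 1ℤ , (λ ()) , [] , const 1ℤ , ⊗-identityˡ (const 1ℤ)
comaximal-∏ {f} {g ∷ gs} (c ∷ cs) = comaximal-⊗ {f} {g} {∏ gs} c (comaximal-∏ cs)

-- With P the product of the tail, F = f h, N F = h′ P and M = u f + v P, one gets M N F = u f (h′
-- P) + v P (N f h), and both summands are multiples of f P.
∏-divides : ∀ {fs F} → AllPairs Comaximal fs → All (λ f → ∃ λ h → f ⊗ h ≈ F) fs →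
  ∃ λ N → N ≢ 0ℤ × ∃ λ h → h ⊗ ∏ fs ≈ const N ⊗ F
∏-divides {F = F} [] [] = 1ℤ , (λ ()) , F , ⊗-comm F (const 1ℤ)
∏-divides {f ∷ fs} {F} (cs ∷ css) ((h , fh) ∷ ds) with ∏-divides css ds | comaximal-∏ cs
... | N , N≢0 , h′ , h′P | M , M≢0 , u , v , uf+vP =
  M * N , *-≢0 M≢0 N≢0 , u ⊗ h′ ⊕ v ⊗ const N ⊗ h , (begin
    (u ⊗ h′ ⊕ v ⊗ const N ⊗ h) ⊗ (f ⊗ P)
      ≈⟨ solve 7 (λ u v n h h′ f P →
           (u :* h′ :+ v :* n :* h) :* (f :* P) := u :* f :* (h′ :* P) :+ v :* P :* (n :* (f :* h)))
         ≈-refl u v (const N) h h′ f P ⟩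
    u ⊗ f ⊗ (h′ ⊗ P) ⊕ v ⊗ P ⊗ (const N ⊗ (f ⊗ h))
      ≈⟨ ⊕-cong (⊗-congˡ (u ⊗ f) h′P) (⊗-congˡ (v ⊗ P) (⊗-congˡ (const N) fh)) ⟩
    u ⊗ f ⊗ (const N ⊗ F) ⊕ v ⊗ P ⊗ (const N ⊗ F)   ≈⟨ ⊗-distribʳ (const N ⊗ F) (u ⊗ f) (v ⊗ P) ⟨
    (u ⊗ f ⊕ v ⊗ P) ⊗ (const N ⊗ F)                 ≈⟨ ⊗-cong uf+vP ≈-refl ⟩
    const M ⊗ (const N ⊗ F)                         ≈⟨ ⊗-assoc (const M) (const N) F ⟨
    const M ⊗ const N ⊗ F                           ≈⟨ ⊗-cong (const-homo-* M N) ≈-refl ⟩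
    const (M * N) ⊗ F                               ∎)
  where
  open ≈-Reasoning
  P = ∏ fs

-- The polynomials xⁿ - 1 and the ideals they generate.

X : Poly
X = 0ℤ ∷ 1ℤ ∷ []

monomial : ℕ → Poly
monomial n = replicate n 0ℤ ++ 1ℤ ∷ []

X-⊗ : ∀ f → X ⊗ f ≈ 0ℤ ∷ f
X-⊗ f = begin
  0ℤ · f ⊕ (0ℤ ∷ const 1ℤ ⊗ f)   ≈⟨ ⊕-cong (0· f) (∷-cong refl (⊗-identityˡ f)) ⟩
  0ℤ ∷ f                         ∎
  where open ≈-Reasoning

X↑-monomial : ∀ n → X ↑ n ≈ monomial n
X↑-monomial zero    = ≈-refl
X↑-monomial (suc n) = ≈-trans (X-⊗ (X ↑ n)) (∷-cong refl (X↑-monomial n))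

-- Brings powers of `X` into the shape `1# + t` required by `geometric` and `1+-cancel`.
X↑-≈ : ∀ n → X ↑ n ≈ const 1ℤ ⊕ xⁿ-1 n
X↑-≈ n = begin
  X ↑ n                                  ≈⟨ X↑-monomial n ⟩
  monomial n                             ≈⟨ ⊕-cong 0∷[] (≈-refl {monomial n}) ⟨
  -- `const 1ℤ ⊕ const -1ℤ` evaluates to `0ℤ ∷ []`.
  (0ℤ ∷ []) ⊕ monomial n                 ≈⟨ ⊕-assoc (const 1ℤ) (const -1ℤ) (monomial n) ⟩
  const 1ℤ ⊕ (const -1ℤ ⊕ monomial n)    ∎
  where open ≈-Reasoning

leading-monomial : ∀ n → Leading (monomial n) n 1ℤ
leading-monomial zero    = leading refl λ { (s<s _) → refl }
leading-monomial (suc n) with leading top above ← leading-monomial n =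
  leading top λ { (s<s n<k) → above n<k }

monic-xⁿ-1 : ∀ n .{{_ : NonZero n}} → Monic (xⁿ-1 n)
monic-xⁿ-1 (suc n) with leading top above ← leading-monomial n =
  suc n , leading top λ { (s<s n<k) → above n<k }

coeff-xⁿ-1-≢0 : ∀ n k → coeff (xⁿ-1 n) k ≢ 0ℤ → k ≡ 0 ⊎ k ≡ n
coeff-xⁿ-1-≢0 n       zero    _  = inj₁ refl
coeff-xⁿ-1-≢0 zero    (suc k) ≢0 = contradiction refl ≢0
coeff-xⁿ-1-≢0 (suc n) (suc k) ≢0 = inj₂ (cong suc (monomial-≢0 n k ≢0))
  where
  monomial-≢0 : ∀ n k → coeff (monomial n) k ≢ 0ℤ → k ≡ n
  monomial-≢0 zero    zero    _  = refl
  monomial-≢0 zero    (suc k) ≢0 = contradiction refl ≢0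
  monomial-≢0 (suc n) zero    ≢0 = contradiction refl ≢0
  monomial-≢0 (suc n) (suc k) ≢0 = cong suc (monomial-≢0 n k ≢0)

supported-xⁿ-1 : ∀ {p n} → p ∣ n → Supported p 0 (xⁿ-1 n)
supported-xⁿ-1 {p} {n} p∣n k ≢0 with coeff-xⁿ-1-≢0 n k ≢0
... | inj₁ refl = p ∣0
... | inj₂ refl = p∣n

-- `geometric` at y = X^m, so that `B` is (X^(qm) - 1) / (X^m - 1) when m is positive.
X↑-multiple : ∀ m q → ∃₂ λ B B′ →
  X ↑ (q ℕ.* m) ≈ const 1ℤ ⊕ xⁿ-1 m ⊗ B × B ≈ const (+ q) ⊕ xⁿ-1 m ⊗ B′
X↑-multiple m q with geometric {t = xⁿ-1 m} (X↑-≈ m) q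
... | B , B′ , eq , eq′ = B , B′ ,
  (begin
    X ↑ (q ℕ.* m)   ≈⟨ ^-congʳ X (ℕ.*-comm q m) ⟩
    X ↑ (m ℕ.* q)   ≈⟨ ^-assocʳ X m q ⟨
    (X ↑ m) ↑ q     ≈⟨ eq ⟩
    const 1ℤ ⊕ xⁿ-1 m ⊗ B ∎) ,
  ≈-trans eq′ (⊕-cong (⊠-const q) (≈-refl {xⁿ-1 m ⊗ B′}))
  where open ≈-Reasoning

xⁿ-1-multiple : ∀ m q → ∃₂ λ B B′ → xⁿ-1 (q ℕ.* m) ≈ xⁿ-1 m ⊗ B × B ≈ const (+ q) ⊕ xⁿ-1 m ⊗ B′
xⁿ-1-multiple m q with X↑-multiple m q
... | B , B′ , eq , eq′ = B , B′ ,
  ∙-cancelˡ (const 1ℤ) _ _ (≈-trans (≈-sym (X↑-≈ (q ℕ.* m))) eq) , eq′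

xⁿ-1-∣ : ∀ {m n} → m ∣ n → ∃ λ h → xⁿ-1 m ⊗ h ≈ xⁿ-1 n
xⁿ-1-∣ {m} (divides q refl) with B , _ , eq , _ ← xⁿ-1-multiple m q = B , ≈-sym eq

private
  -- The exponents give X^g X^(y e) = X^(x d), with no negative power. Write the three powers as 1 +
  -- (X^g - 1), 1 + (X^e - 1) B and 1 + (X^d - 1) A, and solve for X^g - 1.
  xⁿ-1-combination : ∀ d e x y {g} → g ℕ.+ y ℕ.* e ≡ x ℕ.* d →
    ∃₂ λ u v → xⁿ-1 g ≈ u ⊗ xⁿ-1 d ⊕ v ⊗ xⁿ-1 e
  xⁿ-1-combination d e x y {g} eq with X↑-multiple d x | X↑-multiple e y
  ... | A , _ , xd , _ | B , _ , ye , _ = A , w ⊗ B , (begin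
    xⁿ-1 g                                ≈⟨ 1+-cancel (begin
      (const 1ℤ ⊕ xⁿ-1 g) ⊗ (const 1ℤ ⊕ xⁿ-1 e ⊗ B)  ≈⟨ ⊗-cong (X↑-≈ g) ye ⟨
      X ↑ g ⊗ X ↑ (y ℕ.* e)                          ≈⟨ ^-homo-* X g (y ℕ.* e) ⟨
      X ↑ (g ℕ.+ y ℕ.* e)                            ≈⟨ ^-congʳ X eq ⟩
      X ↑ (x ℕ.* d)                                  ≈⟨ xd ⟩
      const 1ℤ ⊕ xⁿ-1 d ⊗ A                          ∎) ⟩
    xⁿ-1 d ⊗ A ⊕ w ⊗ (xⁿ-1 e ⊗ B)         ≈⟨ solve 5 (λ d A w e B → d :* A :+ w :* (e :* B) := A :* d :+ w :* B :* e)
                                               ≈-refl (xⁿ-1 d) A w (xⁿ-1 e) B ⟩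
    A ⊗ xⁿ-1 d ⊕ w ⊗ B ⊗ xⁿ-1 e           ∎)
    where
    open ≈-Reasoning
    w = -1ℤ · (const 1ℤ ⊕ xⁿ-1 g)

xⁿ-1-Bézout : ∀ {d e g} → Bézout.Identity g d e → ∃₂ λ u v → xⁿ-1 g ≈ u ⊗ xⁿ-1 d ⊕ v ⊗ xⁿ-1 e
xⁿ-1-Bézout {d} {e} (Bézout.+- x y eq) = xⁿ-1-combination d e x y eq
xⁿ-1-Bézout {d} {e} (Bézout.-+ x y eq) =
  let v , u , t≈ = xⁿ-1-combination e d y x eq
  in u , v , ≈-trans t≈ (⊕-comm (v ⊗ xⁿ-1 e) (u ⊗ xⁿ-1 d))

-- Lists of divisors.

properDivisors : ℕ → List ℕ
properDivisors n = map toℕ (filter (λ (d : Fin n) → toℕ d ∣? n) (allFin n))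

divisors : ℕ → List ℕ
divisors n = n ∷ properDivisors n

private
  toℕ-∣? : ∀ n (d : Fin n) → Dec (toℕ d ∣ n)
  toℕ-∣? n d = toℕ d ∣? n

∈-properDivisors⁻ : ∀ {d n} → d ∈ properDivisors n → d < n × d ∣ n
∈-properDivisors⁻ {n = n} d∈ with d′ , _ , refl , d∣n ← ∈-map∘filter⁻ toℕ (toℕ-∣? n) {xs = allFin n} d∈ =
  toℕ<n d′ , d∣n

∈-properDivisors⁺ : ∀ {d n} → d < n → d ∣ n → d ∈ properDivisors n
∈-properDivisors⁺ {d} {n} d<n d∣n = ∈-map∘filter⁺ toℕ (toℕ-∣? n)
  (fromℕ< d<n , ∈-allFin _ , sym (toℕ-fromℕ< d<n) , subst (_∣ n) (sym (toℕ-fromℕ< d<n)) d∣n)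

properDivisors-unique : ∀ n → Unique (properDivisors n)
properDivisors-unique n = Unique.map⁺ toℕ-injective (Unique.filter⁺ (toℕ-∣? n) (Unique.allFin⁺ n))

divisors-unique : ∀ n → Unique (divisors n)
divisors-unique n =
  All.tabulate (λ d∈ n≡d → ℕ.<-irrefl (sym n≡d) (proj₁ (∈-properDivisors⁻ d∈))) ∷ properDivisors-unique n

∈-divisors⁻ : ∀ {d n} → d ∈ divisors n → d ∣ n
∈-divisors⁻ (here refl) = ∣-refl
∈-divisors⁻ (there d∈)  = proj₂ (∈-properDivisors⁻ d∈)

∈-divisors⁺ : ∀ {d n} .{{_ : NonZero n}} → d ∣ n → d ∈ divisors n
∈-divisors⁺ d∣n with ℕ.m≤n⇒m<n∨m≡n (∣⇒≤ d∣n)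
... | inj₁ d<n  = there (∈-properDivisors⁺ d<n d∣n)
... | inj₂ refl = here refl

divisors∤ : ℕ → ℕ → List ℕ
divisors∤ n m = filter (∁? (_∣? m)) (properDivisors n)

-- Partition by divisibility into m. As m < n, the first half has the same members as `divisors m`;
-- both lists are free of repetitions, hence permutations of each other.
properDivisors-split : ∀ {m n} .{{_ : NonZero m}} → m ∣ n → m < n →
  properDivisors n ↭ divisors m ++ divisors∤ n m
properDivisors-split {m} {n} m∣n m<n = ↭-trans
  (subst (properDivisors n ↭_) (cong (λ (ys , zs) → ys ++ zs) (partition-defn (_∣? m) (properDivisors n)))
    (↭ₛ⇒↭ (↭ₛ.partition-↭ (setoid ℕ) (_∣? m) (properDivisors n))))
  (↭.++⁺ʳ (divisors∤ n m) (∼bag⇒↭ (unique∧set⇒bag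
    (Unique.filter⁺ (_∣? m) (properDivisors-unique n)) (divisors-unique m)
    (mk⇔
      (λ d∈ → ∈-divisors⁺ (proj₂ (∈-filter⁻ (_∣? m) {xs = properDivisors n} d∈)))
      (λ d∈ → let d∣m = ∈-divisors⁻ d∈ in
        ∈-filter⁺ (_∣? m) (∈-properDivisors⁺ (ℕ.≤-<-trans (∣⇒≤ d∣m) m<n) (∣-trans d∣m m∣n)) d∣m)))))

-- Products over divisors and the factorisation of xⁿ - 1.

∏-↭ : ∀ {xs ys : List ℕ} (f : ℕ → Poly) → xs ↭ ys → ∏ (map f xs) ≈ ∏ (map f ys)
∏-↭ f xs↭ys = ↭ₛ.foldr-commMonoid ⊕.setoid *-isCommutativeMonoid (↭⇒↭ₛ′ ≈-isEquivalence (↭.map⁺ f xs↭ys))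

∏-++ : ∀ fs gs → ∏ (fs ++ gs) ≈ ∏ fs ⊗ ∏ gs
∏-++ []       gs = ≈-sym (⊗-identityˡ (∏ gs))
∏-++ (f ∷ fs) gs = ≈-trans (⊗-congˡ f (∏-++ fs gs)) (≈-sym (⊗-assoc f (∏ fs) (∏ gs)))

-- Well-founded recursion does not compute at a variable n. The fixed-point equation requires a step
-- that respects pointwise equality of recursive calls, which `map-cong` supplies.
Φ-unfold : ∀ n → Φ n ≡ xⁿ-1 n quot ∏ (map Φ (properDivisors n))
Φ-unfold n = trans
  (FixPoint.unfold-wfRec <-wellFounded (λ _ → Poly) step
    (λ m eq → cong (λ fs → xⁿ-1 m quot ∏ fs) (map-cong (λ d → eq (toℕ<n d)) (filter (toℕ-∣? m) (allFin m)))) {n})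
  (cong (λ fs → xⁿ-1 n quot ∏ fs) (map-∘ (filter (toℕ-∣? n) (allFin n))))
  where
  step : ∀ m → (∀ {d} → d < m → Poly) → Poly
  step m Φ< = xⁿ-1 m quot ∏ (map (λ (d : Fin m) → Φ< (toℕ<n d)) (filter (λ d → toℕ d ∣? m) (allFin m)))

-- As `divisors n` begins with n, `∏-≈` says that the division defining `Φ n` leaves no remainder.
record Factorised (n : ℕ) : Set where
  field
    monic  : Monic (Φ n)
    ∏-≈    : ∏ (map Φ (divisors n)) ≈ xⁿ-1 n
open Factorised

-- Collects the divisors of m into one factor. It is applied with m a gcd for comaximality, and with
-- m = n / p for the exponents.
∏-properDivisors : ∀ {m n} .{{_ : NonZero m}} → Factorised m → m ∣ n → m < n →
  ∏ (map Φ (properDivisors n)) ≈ xⁿ-1 m ⊗ ∏ (map Φ (divisors∤ n m))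
∏-properDivisors {m} {n} fm m∣n m<n = begin
  ∏ (map Φ (properDivisors n))                     ≈⟨ ∏-↭ Φ (properDivisors-split m∣n m<n) ⟩
  ∏ (map Φ (divisors m ++ rest))                   ≡⟨ cong ∏ (map-++ Φ (divisors m) rest) ⟩
  ∏ (map Φ (divisors m) ++ map Φ rest)             ≈⟨ ∏-++ (map Φ (divisors m)) (map Φ rest) ⟩
  ∏ (map Φ (divisors m)) ⊗ ∏ (map Φ rest)          ≈⟨ ⊗-cong (∏-≈ fm) (≈-refl {∏ (map Φ rest)}) ⟩
  xⁿ-1 m ⊗ ∏ (map Φ rest)                          ∎
  where
  open ≈-Reasoning
  rest = divisors∤ n m

⊗-cancelˡ : ∀ f {g h} → Monic f → f ⊗ g ≈ f ⊗ h → g ≈ h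
⊗-cancelˡ f {g} {h} mf eq = x∙y⁻¹≈ε⇒x≈y g h (monic-⊗-zero (g ⊕ -1ℤ · h) mf (begin
  (g ⊕ -1ℤ · h) ⊗ f             ≈⟨ ⊗-comm (g ⊕ -1ℤ · h) f ⟩
  f ⊗ (g ⊕ -1ℤ · h)             ≈⟨ ⊗-distribˡ f g (-1ℤ · h) ⟩
  f ⊗ g ⊕ f ⊗ (-1ℤ · h)         ≈⟨ ⊕-cong eq (≈-sym (-‿distribʳ-* f h)) ⟩
  f ⊗ h ⊕ -1ℤ · (f ⊗ h)         ≈⟨ ⊕-inverseʳ (f ⊗ h) ⟩
  []                            ∎))
  where
  open ≈-Reasoning

-- As g divides d and e does not, g is a proper divisor of e. So `Φ e` occurs in xᵉ - 1 beside the
-- factors of xᵍ - 1, and cancelling the latter shows that it divides `B`.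
comaximal-Φ-∤ : ∀ {d e g} .{{_ : NonZero d}} .{{_ : NonZero e}} →
  g ∣ d → g ∣ e → Bézout.Identity g d e → e ∤ d →
  (∀ {m} .{{_ : NonZero m}} → m ≤ e → Factorised m) → Factorised d → Comaximal (Φ d) (Φ e)
comaximal-Φ-∤ {d} {e} {g} g∣d g∣e@(divides q e≡q*g) bézout e∤d fact fd
  with xⁿ-1-Bézout bézout | xⁿ-1-multiple g q
... | u , v , t≈ | B , B′ , e≈ , B≈ =
  + q , q≢0 , u′ ⊗ D , v′ ⊗ R , (begin
    u′ ⊗ D ⊗ Φ d ⊕ v′ ⊗ R ⊗ Φ e    ≈⟨ solve 6 (λ u′ D Φd v′ R Φe →
        u′ :* D :* Φd :+ v′ :* R :* Φe := u′ :* (Φd :* D) :+ v′ :* (Φe :* R)) ≈-refl u′ D (Φ d) v′ R (Φ e) ⟩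
    u′ ⊗ (Φ d ⊗ D) ⊕ v′ ⊗ (Φ e ⊗ R)  ≈⟨ ⊕-cong (⊗-congˡ u′ (∏-≈ fd)) (⊗-congˡ v′ ΦR≈B) ⟩
    u′ ⊗ xⁿ-1 d ⊕ v′ ⊗ B             ≈⟨ comaximal {t = xⁿ-1 g} {u = u} {v = v} B≈
                                         (≈-trans t≈ (⊕-cong (≈-refl {u ⊗ xⁿ-1 d}) (⊗-congˡ v e≈′))) ⟩
    const (+ q)                      ∎)
  where
  open ≈-Reasoning
  instance
    g≢0 : NonZero g
    g≢0 = ℕ.≢-nonZero λ { refl → ℕ.≢-nonZero⁻¹ e (0∣⇒≡0 g∣e) }
  g<e : g < e
  g<e = ℕ.≤∧≢⇒< (∣⇒≤ g∣e) λ { refl → e∤d g∣d }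
  q≢0 : + q ≢ 0ℤ
  q≢0 refl = ℕ.≢-nonZero⁻¹ e e≡q*g
  D = ∏ (map Φ (properDivisors d))
  R = ∏ (map Φ (divisors∤ e g))
  -- The multipliers of xᵈ - 1 and `B` that `comaximal` yields for t = xᵍ - 1.
  u′ = -1ℤ · (B′ ⊗ u)
  v′ = const 1ℤ ⊕ -1ℤ · (B′ ⊗ v ⊗ xⁿ-1 g)
  e≈′ : xⁿ-1 e ≈ xⁿ-1 g ⊗ B
  e≈′ = subst (λ n → xⁿ-1 n ≈ xⁿ-1 g ⊗ B) (sym e≡q*g) e≈
  ΦR≈B : Φ e ⊗ R ≈ B
  ΦR≈B = ⊗-cancelˡ (xⁿ-1 g) (monic-xⁿ-1 g) (begin
    xⁿ-1 g ⊗ (Φ e ⊗ R)      ≈⟨ solve 3 (λ t φ R → t :* (φ :* R) := φ :* (t :* R)) ≈-refl (xⁿ-1 g) (Φ e) R ⟩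
    Φ e ⊗ (xⁿ-1 g ⊗ R)      ≈⟨ ⊗-congˡ (Φ e) (∏-properDivisors (fact (ℕ.<⇒≤ g<e)) g∣e g<e) ⟨
    ∏ (map Φ (divisors e))  ≈⟨ ∏-≈ (fact ℕ.≤-refl) ⟩
    xⁿ-1 e                  ≈⟨ e≈′ ⟩
    xⁿ-1 g ⊗ B              ∎)

-- Distinct d and e cannot divide each other both ways, and the relation is symmetric.
comaximal-Φ : ∀ {d e} .{{_ : NonZero d}} .{{_ : NonZero e}} → d ≢ e →
  (∀ {m} .{{_ : NonZero m}} → m ≤ d ⊎ m ≤ e → Factorised m) → Comaximal (Φ d) (Φ e)
comaximal-Φ {d} {e} d≢e fact with e ∣? d
... | no e∤d  = comaximal-Φ-∤ (gcd[m,n]∣m d e) (gcd[m,n]∣n d e) (Bézout.identity (gcd-GCD d e))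
  e∤d (fact ∘ inj₂) (fact (inj₁ ℕ.≤-refl))
... | yes e∣d = comaximal-sym {Φ e} {Φ d}
  (comaximal-Φ-∤ (gcd[m,n]∣m e d) (gcd[m,n]∣n e d) (Bézout.identity (gcd-GCD e d))
    (λ d∣e → d≢e (∣-antisym d∣e e∣d)) (fact ∘ inj₁) (fact (inj₂ ℕ.≤-refl)))

-- Strong induction works because comaximality of `Φ d` and `Φ e` rests only on factorisations at
-- indices up to d or e, which are below n for proper divisors.
factorised : ∀ n .{{_ : NonZero n}} → Factorised n
factorised n {{n≢0}} = <-rec (λ n → .(NonZero n) → Factorised n) step n n≢0
  where
  step : ∀ n → (∀ {m} → m < n → .(NonZero m) → Factorised m) → .(NonZero n) → Factorised n
  step n rec n≢0 = record { monic = monic-factor (monic-resp-≈ (≈-sym product) (monic-xⁿ-1 n)) monic-D ; ∏-≈ = product }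
    where
    instance
      n-nonZero : NonZero n
      n-nonZero = ℕ.≢-nonZero (ℕ.≢-nonZero⁻¹ n {{n≢0}})
    ds = properDivisors n
    D = ∏ (map Φ ds)

    properDivisor-nonZero : ∀ {d} → d ∈ ds → NonZero d
    properDivisor-nonZero d∈ = ℕ.≢-nonZero λ { refl →
      ℕ.≢-nonZero⁻¹ n (0∣⇒≡0 (proj₂ (∈-properDivisors⁻ d∈))) }
    fact : ∀ {d} → d ∈ ds → Factorised d
    fact d∈ = rec (proj₁ (∈-properDivisors⁻ d∈)) (properDivisor-nonZero d∈)

    monic-D : Monic D
    monic-D = monic-∏ (All.map⁺ (All.tabulate (monic ∘ fact)))

    each-divides : All (λ f → ∃ λ h → f ⊗ h ≈ xⁿ-1 n) (map Φ ds)
    each-divides = All.map⁺ (All.tabulate λ {d} d∈ →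
      -- The cofactor of `Φ d` is that in xᵈ - 1, times (xⁿ - 1) / (xᵈ - 1).
      let h , eq = xⁿ-1-∣ (proj₂ (∈-properDivisors⁻ d∈))
          D′ = ∏ (map Φ (properDivisors d))
      in D′ ⊗ h , ≈-trans (≈-sym (⊗-assoc (Φ d) D′ h)) (≈-trans (⊗-cong (∏-≈ (fact d∈)) (≈-refl {h})) eq))

    comaximal-distinct : ∀ {d e} → d ∈ ds → e ∈ ds → d ≢ e → Comaximal (Φ d) (Φ e)
    comaximal-distinct {d} {e} d∈ e∈ d≢e = comaximal-Φ {d} {e} {{properDivisor-nonZero d∈}} {{properDivisor-nonZero e∈}} d≢e
      λ { {{m≢0}} (inj₁ m≤d) → rec (ℕ.≤-<-trans m≤d (proj₁ (∈-properDivisors⁻ d∈))) m≢0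
        ; {{m≢0}} (inj₂ m≤e) → rec (ℕ.≤-<-trans m≤e (proj₁ (∈-properDivisors⁻ e∈))) m≢0 }

    pairwise : ∀ {xs} → (∀ {d e} → d ∈ xs → e ∈ xs → d ≢ e → Comaximal (Φ d) (Φ e)) → Unique xs →
      AllPairs Comaximal (map Φ xs)
    pairwise c []       = []
    pairwise c (x∉ ∷ u) =
      All.map⁺ (All.tabulate λ e∈ → c (here refl) (there e∈) (All.lookup x∉ e∈)) ∷
      pairwise (λ d∈ e∈ → c (there d∈) (there e∈)) u

    product : Φ n ⊗ D ≈ xⁿ-1 n
    product with N , N≢0 , h , eq ← ∏-divides (pairwise comaximal-distinct (properDivisors-unique n)) each-divides =
      subst (λ f → f ⊗ D ≈ xⁿ-1 n) (sym (Φ-unfold n)) (quot-exact {h = h} N≢0 monic-D eq)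

-- Exponents of `Φ n` when p² divides n.

cofactor-∤ : ∀ {p m d e} .{{_ : NonZero p}} → m ℕ.* p ≡ e ℕ.* d → d ∤ m → p ∤ e
cofactor-∤ {p} {m} {d} mp≡ed d∤m (divides e′ refl) =
  -- A factor p of e would cancel against the p in m p and leave m = e′ d.
  d∤m (divides e′ (ℕ.*-cancelʳ-≡ m (e′ ℕ.* d) p (trans mp≡ed (ℕ*.xy∙z≈xz∙y e′ p d))))

-- In m p = e d the cofactor e is prime to p, so d = d′ p and m = e d′. Now p divides m but not e,
-- hence divides d′.
p²∣divisor : ∀ {p m d} → Prime p → p ∣ m → d ∣ m ℕ.* p → d ∤ m → p ^ 2 ∣ d
p²∣divisor {p} {m} {d} pr p∣m (divides e mp≡ed) d∤m with euclidsLemma e d pr (divides m (sym mp≡ed))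
... | inj₁ p∣e = contradiction p∣e (cofactor-∤ {{prime⇒nonZero pr}} mp≡ed d∤m)
... | inj₂ (divides d′ refl) with euclidsLemma e d′ pr (subst (p ∣_) m≡ed′ p∣m)
  where
  m≡ed′ : m ≡ e ℕ.* d′
  m≡ed′ = ℕ.*-cancelʳ-≡ m (e ℕ.* d′) p {{prime⇒nonZero pr}} (trans mp≡ed (sym (ℕ.*-assoc e d′ p)))
... | inj₁ p∣e  = contradiction p∣e (cofactor-∤ {{prime⇒nonZero pr}} mp≡ed d∤m)
-- `p ^ 2` unfolds to `p ℕ.* (p ℕ.* 1)`.
... | inj₂ p∣d′ = subst (_∣ d′ ℕ.* p) (cong (p ℕ.*_) (sym (ℕ.*-identityʳ p))) (*-monoˡ-∣ p p∣d′)

-- The divisors of m = n / p may fail to be multiples of p², so they enter only through their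
-- product xᵐ - 1; the induction hypothesis is called for the other proper divisors.
supported-Φ : ∀ {p} → Prime p → ∀ n .{{_ : NonZero n}} → p ^ 2 ∣ n → Supported p 0 (Φ n)
supported-Φ {p} pr n {{n≢0}} =
  <-rec (λ n → .(NonZero n) → p ^ 2 ∣ n → Supported p 0 (Φ n)) step n n≢0
  where
  step : ∀ n → (∀ {m} → m < n → .(NonZero m) → p ^ 2 ∣ m → Supported p 0 (Φ m)) →
    .(NonZero n) → p ^ 2 ∣ n → Supported p 0 (Φ n)
  step n rec n≢0 (divides r n≡r*p²) =
    subst (Supported p 0) (sym (Φ-unfold n))
      (proj₁ (supported-divMod (proj₂ monic-D) supported-D (xⁿ-1 n) (supported-xⁿ-1 {p} {n} (∣-trans p∣m m∣n))))
    where
    -- Here n = r p², so m is n / p and still a multiple of p.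
    m = r ℕ.* p
    n≡m*p : n ≡ m ℕ.* p
    n≡m*p = trans n≡r*p² (trans (cong (λ q → r ℕ.* (p ℕ.* q)) (ℕ.*-identityʳ p)) (sym (ℕ.*-assoc r p p)))
    instance
      n-nonZero : NonZero n
      n-nonZero = ℕ.≢-nonZero (ℕ.≢-nonZero⁻¹ n {{n≢0}})
      m≢0 : NonZero m
      m≢0 = ℕ.≢-nonZero λ m≡0 → ℕ.≢-nonZero⁻¹ n (trans n≡m*p (cong (ℕ._* p) m≡0))
    m∣n : m ∣ n
    m∣n = subst (m ∣_) (sym n≡m*p) (m∣m*n p)
    m<n : m < n
    m<n = subst (m <_) (sym n≡m*p) (ℕ.m<m*n m p (nonTrivial⇒n>1 p {{prime⇒nonTrivial pr}}))
    p∣m : p ∣ m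
    p∣m = n∣m*n r

    ds = properDivisors n
    D = ∏ (map Φ ds)
    divisor-nonZero : ∀ {d} → d ∣ n → NonZero d
    divisor-nonZero d∣n = ℕ.≢-nonZero λ { refl → ℕ.≢-nonZero⁻¹ n (0∣⇒≡0 d∣n) }

    monic-D : Monic D
    monic-D = monic-∏ (All.map⁺ (All.tabulate λ {d} d∈ →
      monic (factorised d {{divisor-nonZero (proj₂ (∈-properDivisors⁻ d∈))}})))

    supported-new : All (Supported p 0) (map Φ (divisors∤ n m))
    supported-new = All.map⁺ (All.tabulate λ {d} d∈ →
      let d∈ds , d∤m = ∈-filter⁻ (∁? (_∣? m)) {xs = ds} d∈
          d<n , d∣n = ∈-properDivisors⁻ d∈ds
      in rec d<n (divisor-nonZero d∣n) (p²∣divisor pr p∣m (subst (d ∣_) n≡m*p d∣n) d∤m))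

    supported-D : Supported p 0 D
    supported-D = supported-resp-≈ (≈-sym (∏-properDivisors (factorised m) m∣n m<n))
      (supported-⊗ {p} {xⁿ-1 m} {∏ (map Φ (divisors∤ n m))} (supported-xⁿ-1 {p} {m} p∣m) (supported-∏ supported-new))

corollary2p8 : ∀ (p n : ℕ) .{{_ : NonZero n}} → Prime p → p ^ 2 ∣ n →
    ∀ (k : ℕ) → p ∤ k → a n k ≡ 0ℤ
corollary2p8 p n pr p²∣n k p∤k with a n k ≟ 0ℤ
... | yes ≡0 = ≡0
... | no ≢0  = contradiction (supported-Φ pr n p²∣n k ≢0) p∤k
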